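{- Let $\{P_n(x)\}_{n\ge 1}$ be the sequence defined in the context. For every $n\ge1$, $P_n(0)=4^{\lfloor (n-1)/2\rfloor}\,\lfloor \frac{n-1}{2}\rfloor!$.
   Context: The sequence $\{P_n(x)\}_{n\ge1}$ of rational functions of $x$ is defined by $P_1=P_2=1$ and, for $n\ge 2$: if $n$ is odd, $4(2x+n)P_{n+1}(x)=2(x+n)P_n(x)+(2x+n)P_n(x+1)+(4x+n)\ell_n(x)$; if $n$ is even, $4P_{n+1}(x)=4(x+n)P_n(x)+2(2x+n+1)P_n(x+1)+(4x+n)\ell_{n-1}(x)$. Here for odd $r\ge1$, $\ell_r(x)=\prod_{j=1}^{(r-1)/2}(x+j)$ (the empty product equals $1$). -}

module Defs where

open import Data.Nat using (ℕ; zero; suc; _∸_; _%_; _/_) renaming (_+_ to _+ℕ_; _*_ to _*ℕ_)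
open import Data.Integer using (+_)
open import Data.Rational using (ℚ; _+_; _*_) renaming (_/_ to _÷_)
open import Data.Bool using (if_then_else_)
open import Data.Nat using (_≡ᵇ_)

⟦_⟧ : ℕ → ℚ
⟦ k ⟧ = + k ÷ 1

prodTo : ℕ → ℕ → ℚ
prodTo zero    x = ⟦ 1 ⟧
prodTo (suc m) x = prodTo m x * ⟦ x +ℕ suc m ⟧

ℓ : ℕ → ℕ → ℚ
ℓ r x = prodTo ((r ∸ 1) / 2) x

-- Odd n :  P_{n+1}(x) = [2(x+n)P_n(x) + (2x+n)P_n(x+1) + (4x+n)ℓ_n(x)] / (4(2x+n)),
--          and 4(2x+n) = 8x + 4k + 8 = suc (8x + 4k + 7).
step : ℕ → (ℕ → ℚ) → ℕ → ℚ
step k Pn x with (2 +ℕ k) % 2 ≡ᵇ 1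
... | Data.Bool.true =
  (⟦ 2 *ℕ (x +ℕ n) ⟧ * Pn x + ⟦ 2 *ℕ x +ℕ n ⟧ * Pn (suc x) + ⟦ 4 *ℕ x +ℕ n ⟧ * ℓ n x)
    * (+ 1 ÷ suc (8 *ℕ x +ℕ 4 *ℕ k +ℕ 7))
  where n = 2 +ℕ k
... | Data.Bool.false =
  (⟦ 4 *ℕ (x +ℕ n) ⟧ * Pn x + ⟦ 2 *ℕ (2 *ℕ x +ℕ n +ℕ 1) ⟧ * Pn (suc x) + ⟦ 4 *ℕ x +ℕ n ⟧ * ℓ (n ∸ 1) x)
    * (+ 1 ÷ 4)
  where n = 2 +ℕ k

-- P n x = P_n(x) for n ≥ 1, evaluated at natural arguments x (index 0 unused).
P : ℕ → ℕ → ℚ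
P zero x = ⟦ 1 ⟧
P (suc zero) x = ⟦ 1 ⟧
P (suc (suc zero)) x = ⟦ 1 ⟧
P (suc (suc (suc k))) x = step k (P (suc (suc k))) x

-- Each P_n satisfies a first-order difference equation in x: for even n,
-- 2(2x+n+1)P_n(x+1) + n ℓ_{n-1}(x) = 4(x+n)P_n(x), and for odd n,
-- (2x+n)P_n(x+1) + n ℓ_n(x) = 2(x+n)P_n(x). Substituting it into the recurrence eliminates
-- P_n(x+1): P_{n+1}(x) = 2(x+n)P_n(x) + x ℓ_{n-1}(x) for even n, and
-- (2x+n)P_{n+1}(x) = (x+n)P_n(x) + x ℓ_n(x) for odd n. Together with the shift
-- 2(x+1)ℓ_r(x+1) = (2x+r+1)ℓ_r(x) of the products, these carry the difference equation
-- from n to n+1. At x = 0 they read P_{n+1}(0) = 2n P_n(0) for even n and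
-- P_{n+1}(0) = P_n(0) for odd n.
module Submission where

open import Data.Nat as ℕ using (ℕ; zero; suc)
open import Data.Nat.DivMod using (m*n%n≡0; [m+kn]%n≡m%n; m*n/n≡m; +-distrib-/-∣ʳ)
import Data.Nat.Tactic.RingSolver as ℕ-Solver
open import Data.Integer as ℤ using (+_)
import Data.Integer.Properties as ℤ
open import Data.List using (_∷_; [])
open import Relation.Binary.PropositionalEquality using (_≡_; refl; sym; trans; cong; cong₂; module ≡-Reasoning)
open import Defs

cong₃ : ∀ {A B C D : Set} (f : A → B → C → D) {a a′ b b′ c c′} →
        a ≡ a′ → b ≡ b′ → c ≡ c′ → f a b c ≡ f a′ b′ c′
cong₃ f refl refl refl = refl

[2+m*2]%2≡0 : ∀ m → (2 ℕ.+ m ℕ.* 2) ℕ.% 2 ≡ 0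
[2+m*2]%2≡0 m = m*n%n≡0 (suc m) 2

[3+m*2]%2≡1 : ∀ m → (3 ℕ.+ m ℕ.* 2) ℕ.% 2 ≡ 1
[3+m*2]%2≡1 m = [m+kn]%n≡m%n 1 (suc m) 2

-- The arithmetic of ℚ is opened only inside this module, so that _*_ in the theorem is ℕ's.
module _ where
  open import Agda.Builtin.FromNat using (Number; fromNat)
  import Data.Nat.Literals as ℕ-Literals
  open import Data.Unit.Base using (tt)
  open import Data.Rational using (ℚ; _+_; _*_; -_; toℚᵘ) renaming (_/_ to _÷_)
  open import Data.Rational.Literals using (number)
  import Data.Rational.Properties as ℚ
  open import Data.Rational.Properties using (toℚᵘ-injective; toℚᵘ-fromℚᵘ; toℚᵘ-homo-+; toℚᵘ-homo-*)
  open import Data.Rational.Unnormalised as ℚᵘ using (mkℚᵘ; *≡*)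
  import Data.Rational.Unnormalised.Properties as ℚᵘ
  open import Relation.Nullary.Decidable using (dec⇒maybe)
  open import Tactic.RingSolver using (solve-∀; solve)
  open import Tactic.RingSolver.Core.AlmostCommutativeRing using (AlmostCommutativeRing; fromCommutativeRing)
  open import Level using (0ℓ)

  -- With fromNat in scope every numeral is overloaded, those at type ℕ included; the
  -- instance tt discharges their trivial constraint.
  instance
    ℚ-number : Number ℚ
    ℚ-number = number
    ℕ-number : Number ℕ
    ℕ-number = ℕ-Literals.number

  ℚ-ring : AlmostCommutativeRing 0ℓ 0ℓ
  ℚ-ring = fromCommutativeRing ℚ.+-*-commutativeRing (λ q → dec⇒maybe (0 ℚ.≟ q))

  toℚᵘ-⟦⟧ : ∀ k → toℚᵘ ⟦ k ⟧ ℚᵘ.≃ mkℚᵘ (+ k) 0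
  toℚᵘ-⟦⟧ k = toℚᵘ-fromℚᵘ (mkℚᵘ (+ k) 0)

  ⟦⟧-homo-+ : ∀ a b → ⟦ a ℕ.+ b ⟧ ≡ ⟦ a ⟧ + ⟦ b ⟧
  ⟦⟧-homo-+ a b = toℚᵘ-injective (begin
    toℚᵘ ⟦ a ℕ.+ b ⟧                ≈⟨ toℚᵘ-⟦⟧ (a ℕ.+ b) ⟩
    mkℚᵘ (+ (a ℕ.+ b)) 0            ≈⟨ *≡* (cong (ℤ._* + 1) numerators) ⟩
    mkℚᵘ (+ a) 0 ℚᵘ.+ mkℚᵘ (+ b) 0  ≈⟨ ℚᵘ.+-cong (toℚᵘ-⟦⟧ a) (toℚᵘ-⟦⟧ b) ⟨
    toℚᵘ ⟦ a ⟧ ℚᵘ.+ toℚᵘ ⟦ b ⟧      ≈⟨ toℚᵘ-homo-+ ⟦ a ⟧ ⟦ b ⟧ ⟨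
    toℚᵘ (⟦ a ⟧ + ⟦ b ⟧)            ∎)
    where
    open ℚᵘ.≃-Reasoning
    numerators : + (a ℕ.+ b) ≡ + a ℤ.* + 1 ℤ.+ + b ℤ.* + 1
    numerators = trans (ℤ.pos-+ a b) (sym (cong₂ ℤ._+_ (ℤ.*-identityʳ (+ a)) (ℤ.*-identityʳ (+ b))))

  ⟦⟧-homo-* : ∀ a b → ⟦ a ℕ.* b ⟧ ≡ ⟦ a ⟧ * ⟦ b ⟧
  ⟦⟧-homo-* a b = toℚᵘ-injective (begin
    toℚᵘ ⟦ a ℕ.* b ⟧                ≈⟨ toℚᵘ-⟦⟧ (a ℕ.* b) ⟩
    mkℚᵘ (+ (a ℕ.* b)) 0            ≈⟨ *≡* (cong (ℤ._* + 1) (ℤ.pos-* a b)) ⟩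
    mkℚᵘ (+ a) 0 ℚᵘ.* mkℚᵘ (+ b) 0  ≈⟨ ℚᵘ.*-cong (toℚᵘ-⟦⟧ a) (toℚᵘ-⟦⟧ b) ⟨
    toℚᵘ ⟦ a ⟧ ℚᵘ.* toℚᵘ ⟦ b ⟧      ≈⟨ toℚᵘ-homo-* ⟦ a ⟧ ⟦ b ⟧ ⟨
    toℚᵘ (⟦ a ⟧ * ⟦ b ⟧)            ∎)
    where open ℚᵘ.≃-Reasoning

  infixl 6 _⟨+⟩_
  infixl 7 _⟨*⟩_

  -- A derivation of ⟦ a ⟧ ≡ A by pushing ⟦_⟧ through + and *. Its indices let unification
  -- read off the ℕ-expression a, which it cannot recover from ⟦ a ⟧ itself.
  data Cast : ℕ → ℚ → Set where
    cast  : ∀ k → Cast k ⟦ k ⟧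
    _⟨+⟩_ : ∀ {a b A B} → Cast a A → Cast b B → Cast (a ℕ.+ b) (A + B)
    _⟨*⟩_ : ∀ {a b A B} → Cast a A → Cast b B → Cast (a ℕ.* b) (A * B)

  ⟦_⟧≡ : ∀ {a A} → Cast a A → ⟦ a ⟧ ≡ A
  ⟦ cast k ⟧≡ = refl
  ⟦ _⟨+⟩_ {a} {b} p q ⟧≡ = trans (⟦⟧-homo-+ a b) (cong₂ _+_ ⟦ p ⟧≡ ⟦ q ⟧≡)
  ⟦ _⟨*⟩_ {a} {b} p q ⟧≡ = trans (⟦⟧-homo-* a b) (cong₂ _*_ ⟦ p ⟧≡ ⟦ q ⟧≡)

  ⟦suc⟧ : ∀ n → ⟦ suc n ⟧ ≡ 1 + ⟦ n ⟧
  ⟦suc⟧ n = ⟦ cast 1 ⟨+⟩ cast n ⟧≡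

  ⟦suc⟧*1/suc : ∀ e → ⟦ suc e ⟧ * (+ 1 ÷ suc e) ≡ 1
  ⟦suc⟧*1/suc e = toℚᵘ-injective (begin
    toℚᵘ (⟦ suc e ⟧ * (+ 1 ÷ suc e))             ≈⟨ toℚᵘ-homo-* ⟦ suc e ⟧ (+ 1 ÷ suc e) ⟩
    toℚᵘ ⟦ suc e ⟧ ℚᵘ.* toℚᵘ (+ 1 ÷ suc e)       ≈⟨ ℚᵘ.*-cong (toℚᵘ-⟦⟧ (suc e)) (toℚᵘ-fromℚᵘ (mkℚᵘ (+ 1) e)) ⟩
    mkℚᵘ (+ suc e) 0 ℚᵘ.* mkℚᵘ (+ 1) e          ≈⟨ ℚᵘ.*-inverseʳ (mkℚᵘ (+ suc e) 0) ⟩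
    ℚᵘ.1ℚᵘ                                       ∎)
    where open ℚᵘ.≃-Reasoning

  ⟦suc⟧*[q*1/suc]≡q : ∀ e q → ⟦ suc e ⟧ * (q * (+ 1 ÷ suc e)) ≡ q
  ⟦suc⟧*[q*1/suc]≡q e q = begin
    ⟦ suc e ⟧ * (q * (+ 1 ÷ suc e))   ≡⟨ cong (⟦ suc e ⟧ *_) (ℚ.*-comm q _) ⟩
    ⟦ suc e ⟧ * ((+ 1 ÷ suc e) * q)   ≡⟨ ℚ.*-assoc ⟦ suc e ⟧ (+ 1 ÷ suc e) q ⟨
    ⟦ suc e ⟧ * (+ 1 ÷ suc e) * q     ≡⟨ cong (_* q) (⟦suc⟧*1/suc e) ⟩
    1 * q                             ≡⟨ ℚ.*-identityˡ q ⟩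
    q                                 ∎
    where open ≡-Reasoning

  *-cancelˡ-⟦suc⟧ : ∀ e {a b} → ⟦ suc e ⟧ * a ≡ ⟦ suc e ⟧ * b → a ≡ b
  *-cancelˡ-⟦suc⟧ e {a} {b} eq = begin
    a                                       ≡⟨ ⟦suc⟧*[q*1/suc]≡q e a ⟨
    ⟦ suc e ⟧ * (a * (+ 1 ÷ suc e))         ≡⟨ ℚ.*-assoc ⟦ suc e ⟧ a _ ⟨
    ⟦ suc e ⟧ * a * (+ 1 ÷ suc e)           ≡⟨ cong (_* (+ 1 ÷ suc e)) eq ⟩
    ⟦ suc e ⟧ * b * (+ 1 ÷ suc e)           ≡⟨ ℚ.*-assoc ⟦ suc e ⟧ b _ ⟩
    ⟦ suc e ⟧ * (b * (+ 1 ÷ suc e))         ≡⟨ ⟦suc⟧*[q*1/suc]≡q e b ⟩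
    b                                       ∎
    where open ≡-Reasoning

  combination-cong : ∀ {a b c w a′ b′ c′ w′} (u v : ℚ) →
                     a ≡ a′ → b ≡ b′ → c ≡ c′ → w ≡ w′ →
                     a * u + b * v + c * w ≡ a′ * u + b′ * v + c′ * w′
  combination-cong u v refl refl refl refl = refl

  ℓ-odd : ∀ j x → ℓ (suc (j ℕ.* 2)) x ≡ prodTo j x
  ℓ-odd j x = cong (λ i → prodTo i x) (m*n/n≡m j 2)

  Pₑ Pₒ : ℕ → ℕ → ℚ
  Pₑ m = P (2 ℕ.+ m ℕ.* 2)
  Pₒ m = P (3 ℕ.+ m ℕ.* 2)

  P-recurrence-even : ∀ m x → let X = ⟦ x ⟧ ; N = ⟦ 2 ℕ.+ m ℕ.* 2 ⟧ in
    4 * Pₒ m x ≡ 4 * (X + N) * Pₑ m x + 2 * (2 * X + N + 1) * Pₑ m (suc x) + (4 * X + N) * prodTo m x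
  P-recurrence-even m x rewrite [2+m*2]%2≡0 m =
    trans (⟦suc⟧*[q*1/suc]≡q 3 _)
          (combination-cong _ _ ⟦ cast 4 ⟨*⟩ (cast x ⟨+⟩ cast n) ⟧≡
                                ⟦ cast 2 ⟨*⟩ (cast 2 ⟨*⟩ cast x ⟨+⟩ cast n ⟨+⟩ cast 1) ⟧≡
                                ⟦ cast 4 ⟨*⟩ cast x ⟨+⟩ cast n ⟧≡ (ℓ-odd m x))
    where
    n = 2 ℕ.+ m ℕ.* 2

  P-recurrence-odd : ∀ m x → let X = ⟦ x ⟧ ; N = ⟦ 3 ℕ.+ m ℕ.* 2 ⟧ in
    4 * (2 * X + N) * Pₑ (suc m) x ≡ 2 * (X + N) * Pₒ m x + (2 * X + N) * Pₒ m (suc x) + (4 * X + N) * prodTo (suc m) x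
  P-recurrence-odd m x rewrite [3+m*2]%2≡1 m =
    trans (cong₂ _*_ denominator refl)
          (trans (⟦suc⟧*[q*1/suc]≡q (8 ℕ.* x ℕ.+ 4 ℕ.* k ℕ.+ 7) _)
                 (combination-cong _ _ ⟦ cast 2 ⟨*⟩ (cast x ⟨+⟩ cast n) ⟧≡ ⟦ cast 2 ⟨*⟩ cast x ⟨+⟩ cast n ⟧≡
                                       ⟦ cast 4 ⟨*⟩ cast x ⟨+⟩ cast n ⟧≡ (ℓ-odd (suc m) x)))
    where
    k = 1 ℕ.+ m ℕ.* 2
    n = 2 ℕ.+ k
    four-denominator : ∀ X K → 4 * (2 * X + (2 + K)) ≡ 1 + (8 * X + 4 * K + 7)
    four-denominator = solve-∀ ℚ-ring
    denominator : 4 * (2 * ⟦ x ⟧ + ⟦ n ⟧) ≡ ⟦ suc (8 ℕ.* x ℕ.+ 4 ℕ.* k ℕ.+ 7) ⟧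
    denominator = begin
      4 * (2 * ⟦ x ⟧ + ⟦ n ⟧)             ≡⟨ cong (λ N → 4 * (2 * ⟦ x ⟧ + N)) ⟦ cast 2 ⟨+⟩ cast k ⟧≡ ⟩
      4 * (2 * ⟦ x ⟧ + (2 + ⟦ k ⟧))       ≡⟨ four-denominator ⟦ x ⟧ ⟦ k ⟧ ⟩
      1 + (8 * ⟦ x ⟧ + 4 * ⟦ k ⟧ + 7)     ≡⟨ ⟦ cast 1 ⟨+⟩ (cast 8 ⟨*⟩ cast x ⟨+⟩ cast 4 ⟨*⟩ cast k ⟨+⟩ cast 7) ⟧≡ ⟨
      ⟦ suc (8 ℕ.* x ℕ.+ 4 ℕ.* k ℕ.+ 7) ⟧ ∎
      where open ≡-Reasoning

  prodTo-suc : ∀ j x → 2 * prodTo (suc j) x ≡ (2 * ⟦ x ⟧ + ⟦ 2 ℕ.+ j ℕ.* 2 ⟧) * prodTo j x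
  prodTo-suc j x =
    identity ⟦ x ⟧ ⟦ j ⟧ (prodTo j x) ⟦ cast x ⟨+⟩ (cast 1 ⟨+⟩ cast j) ⟧≡ ⟦ cast 2 ⟨+⟩ cast j ⟨*⟩ cast 2 ⟧≡
    where
    identity : ∀ X J L {c N} → c ≡ X + (1 + J) → N ≡ 2 + J * 2 → 2 * (L * c) ≡ (2 * X + N) * L
    identity X J L refl refl = solve (X ∷ J ∷ L ∷ []) ℚ-ring

  prodTo-shift : ∀ j x → 2 * (⟦ x ⟧ + 1) * prodTo j (suc x) ≡ (2 * ⟦ x ⟧ + ⟦ 2 ℕ.+ j ℕ.* 2 ⟧) * prodTo j x
  prodTo-shift zero x = identity ⟦ x ⟧
    where
    identity : ∀ X → 2 * (X + 1) * 1 ≡ (2 * X + 2) * 1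
    identity = solve-∀ ℚ-ring
  prodTo-shift (suc j) x =
    induction-step ⟦ x ⟧ ⟦ j ⟧ (prodTo j x) (prodTo j (suc x))
      ⟦ cast 1 ⟨+⟩ cast x ⟨+⟩ (cast 1 ⟨+⟩ cast j) ⟧≡ ⟦ cast x ⟨+⟩ (cast 1 ⟨+⟩ cast j) ⟧≡
      ⟦ cast 4 ⟨+⟩ cast j ⟨*⟩ cast 2 ⟧≡ ⟦ cast 2 ⟨+⟩ cast j ⟨*⟩ cast 2 ⟧≡ (prodTo-shift j x)
    where
    induction-step : ∀ X J L L′ {c c′ N N′} →
      c′ ≡ 1 + X + (1 + J) → c ≡ X + (1 + J) → N′ ≡ 4 + J * 2 → N ≡ 2 + J * 2 →
      2 * (X + 1) * L′ ≡ (2 * X + N) * L → 2 * (X + 1) * (L′ * c′) ≡ (2 * X + N′) * (L * c)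
    induction-step X J L L′ refl refl refl refl shift = begin
      2 * (X + 1) * (L′ * (1 + X + (1 + J)))         ≡⟨ solve (X ∷ J ∷ L′ ∷ []) ℚ-ring ⟩
      2 * (X + 1) * L′ * (X + (2 + J))               ≡⟨ cong (_* (X + (2 + J))) shift ⟩
      (2 * X + (2 + J * 2)) * L * (X + (2 + J))      ≡⟨ solve (X ∷ J ∷ L ∷ []) ℚ-ring ⟩
      (2 * X + (4 + J * 2)) * (L * (X + (1 + J)))    ∎
      where open ≡-Reasoning

  -- The difference equations of P_n for n = 2j+2 and n = 2j+1; there prodTo j is ℓ_{n-1}, resp. ℓ_n.
  EvenShift : ℕ → (ℕ → ℚ) → Set
  EvenShift j f = ∀ x → let X = ⟦ x ⟧ ; N = ⟦ 2 ℕ.+ j ℕ.* 2 ⟧ in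
    2 * (2 * X + N + 1) * f (suc x) + N * prodTo j x ≡ 4 * (X + N) * f x

  OddShift : ℕ → (ℕ → ℚ) → Set
  OddShift j f = ∀ x → let X = ⟦ x ⟧ ; N = ⟦ 1 ℕ.+ j ℕ.* 2 ⟧ in
    (2 * X + N) * f (suc x) + N * prodTo j x ≡ 2 * (X + N) * f x

  Pₒ-from-Pₑ : ∀ m → EvenShift m (Pₑ m) → ∀ x →
    Pₒ m x ≡ 2 * (⟦ x ⟧ + ⟦ 2 ℕ.+ m ℕ.* 2 ⟧) * Pₑ m x + ⟦ x ⟧ * prodTo m x
  Pₒ-from-Pₑ m shift x = *-cancelˡ-⟦suc⟧ 3
    (identity ⟦ x ⟧ ⟦ 2 ℕ.+ m ℕ.* 2 ⟧ (Pₑ m x) (Pₑ m (suc x)) (prodTo m x) (Pₒ m x)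
              (P-recurrence-even m x) (shift x))
    where
    identity : ∀ X N E E′ L O →
      4 * O ≡ 4 * (X + N) * E + 2 * (2 * X + N + 1) * E′ + (4 * X + N) * L →
      2 * (2 * X + N + 1) * E′ + N * L ≡ 4 * (X + N) * E →
      4 * O ≡ 4 * (2 * (X + N) * E + X * L)
    identity X N E E′ L O recurrence shift = begin
      4 * O                                                          ≡⟨ recurrence ⟩
      4 * (X + N) * E + 2 * (2 * X + N + 1) * E′ + (4 * X + N) * L   ≡⟨ solve (X ∷ N ∷ E ∷ E′ ∷ L ∷ []) ℚ-ring ⟩
      4 * (X + N) * E + (2 * (2 * X + N + 1) * E′ + N * L) + 4 * X * L ≡⟨ cong (λ t → 4 * (X + N) * E + t + 4 * X * L) shift ⟩
      4 * (X + N) * E + 4 * (X + N) * E + 4 * X * L                  ≡⟨ solve (X ∷ N ∷ E ∷ L ∷ []) ℚ-ring ⟩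
      4 * (2 * (X + N) * E + X * L)                                  ∎
      where open ≡-Reasoning

  evenShift⇒oddShift : ∀ m → EvenShift m (Pₑ m) → OddShift (suc m) (Pₒ m)
  evenShift⇒oddShift m shift x = *-cancelˡ-⟦suc⟧ 1
    (identity ⟦ x ⟧ ⟦ n ⟧ (Pₑ m x) (Pₑ m (suc x)) (prodTo m x) (prodTo m (suc x)) (prodTo (suc m) x)
              (⟦suc⟧ n) (⟦suc⟧ x) (Pₒ-from-Pₑ m shift x) (Pₒ-from-Pₑ m shift (suc x))
              (shift x) (prodTo-shift m x) (prodTo-suc m x))
    where
    n = 2 ℕ.+ m ℕ.* 2
    identity : ∀ X N E E′ L L′ L⁺ {N′ X′ O O′} → N′ ≡ 1 + N → X′ ≡ 1 + X →
      O ≡ 2 * (X + N) * E + X * L → O′ ≡ 2 * (X′ + N) * E′ + X′ * L′ →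
      2 * (2 * X + N + 1) * E′ + N * L ≡ 4 * (X + N) * E →
      2 * (X + 1) * L′ ≡ (2 * X + N) * L →
      2 * L⁺ ≡ (2 * X + N) * L →
      2 * ((2 * X + N′) * O′ + N′ * L⁺) ≡ 2 * (2 * (X + N′) * O)
    identity X N E E′ L L′ L⁺ refl refl refl refl shift shiftL sucL = begin
      2 * ((2 * X + (1 + N)) * (2 * ((1 + X) + N) * E′ + (1 + X) * L′) + (1 + N) * L⁺)
        ≡⟨ solve (X ∷ N ∷ E′ ∷ L ∷ L′ ∷ L⁺ ∷ []) ℚ-ring ⟩
      2 * (X + N + 1) * (2 * (2 * X + N + 1) * E′ + N * L) + (2 * X + N + 1) * (2 * (X + 1) * L′)
        + (1 + N) * (2 * L⁺) + - (2 * (X + N + 1) * (N * L))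
        ≡⟨ cong₃ (λ a b c → 2 * (X + N + 1) * a + (2 * X + N + 1) * b
                            + (1 + N) * c + - (2 * (X + N + 1) * (N * L)))
                 shift shiftL sucL ⟩
      2 * (X + N + 1) * (4 * (X + N) * E) + (2 * X + N + 1) * ((2 * X + N) * L)
        + (1 + N) * ((2 * X + N) * L) + - (2 * (X + N + 1) * (N * L))
        ≡⟨ solve (X ∷ N ∷ E ∷ L ∷ []) ℚ-ring ⟩
      2 * (2 * (X + (1 + N)) * (2 * (X + N) * E + X * L))
        ∎
      where open ≡-Reasoning

  Pₑ-from-Pₒ : ∀ m → OddShift (suc m) (Pₒ m) → ∀ x → let X = ⟦ x ⟧ ; N = ⟦ 3 ℕ.+ m ℕ.* 2 ⟧ in
    (2 * X + N) * Pₑ (suc m) x ≡ (X + N) * Pₒ m x + X * prodTo (suc m) x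
  Pₑ-from-Pₒ m shift x = *-cancelˡ-⟦suc⟧ 3
    (identity ⟦ x ⟧ ⟦ 3 ℕ.+ m ℕ.* 2 ⟧ (Pₑ (suc m) x) (Pₒ m x) (Pₒ m (suc x)) (prodTo (suc m) x)
              (P-recurrence-odd m x) (shift x))
    where
    identity : ∀ X N E O O′ L →
      4 * (2 * X + N) * E ≡ 2 * (X + N) * O + (2 * X + N) * O′ + (4 * X + N) * L →
      (2 * X + N) * O′ + N * L ≡ 2 * (X + N) * O →
      4 * ((2 * X + N) * E) ≡ 4 * ((X + N) * O + X * L)
    identity X N E O O′ L recurrence shift = begin
      4 * ((2 * X + N) * E)                                        ≡⟨ solve (X ∷ N ∷ E ∷ []) ℚ-ring ⟩
      4 * (2 * X + N) * E                                          ≡⟨ recurrence ⟩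
      2 * (X + N) * O + (2 * X + N) * O′ + (4 * X + N) * L         ≡⟨ solve (X ∷ N ∷ O ∷ O′ ∷ L ∷ []) ℚ-ring ⟩
      2 * (X + N) * O + ((2 * X + N) * O′ + N * L) + 4 * X * L     ≡⟨ cong (λ t → 2 * (X + N) * O + t + 4 * X * L) shift ⟩
      2 * (X + N) * O + 2 * (X + N) * O + 4 * X * L                ≡⟨ solve (X ∷ N ∷ O ∷ L ∷ []) ℚ-ring ⟩
      4 * ((X + N) * O + X * L)                                    ∎
      where open ≡-Reasoning

  oddShift⇒evenShift : ∀ m → OddShift (suc m) (Pₒ m) → EvenShift (suc m) (Pₑ (suc m))
  oddShift⇒evenShift m shift x = *-cancelˡ-⟦suc⟧ (2 ℕ.+ m ℕ.* 2 ℕ.+ 2 ℕ.* x)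
    (identity ⟦ x ⟧ ⟦ n ⟧ (Pₑ (suc m) x) (Pₑ (suc m) (suc x)) (Pₒ m x) (Pₒ m (suc x))
              (prodTo (suc m) x) (prodTo (suc m) (suc x))
              (⟦suc⟧ x) (⟦suc⟧ n) ⟦ cast n ⟨+⟩ cast 2 ⟨*⟩ cast x ⟧≡
              (Pₑ-from-Pₒ m shift x) (Pₑ-from-Pₒ m shift (suc x)) (shift x) (prodTo-shift (suc m) x))
    where
    n = 3 ℕ.+ m ℕ.* 2
    identity : ∀ X N E E′ O O′ L L′ {X′ N′ C} → X′ ≡ 1 + X → N′ ≡ 1 + N → C ≡ N + 2 * X →
      (2 * X + N) * E ≡ (X + N) * O + X * L →
      (2 * X′ + N) * E′ ≡ (X′ + N) * O′ + X′ * L′ →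
      (2 * X + N) * O′ + N * L ≡ 2 * (X + N) * O →
      2 * (X + 1) * L′ ≡ (2 * X + N′) * L →
      C * (2 * (2 * X + N′ + 1) * E′ + N′ * L) ≡ C * (4 * (X + N′) * E)
    identity X N E E′ O O′ L L′ refl refl refl formula formula′ shift shiftL = begin
      (N + 2 * X) * (2 * (2 * X + (1 + N) + 1) * E′ + (1 + N) * L)
        ≡⟨ solve (X ∷ N ∷ E′ ∷ L ∷ []) ℚ-ring ⟩
      (N + 2 * X) * (2 * ((2 * (1 + X) + N) * E′) + (1 + N) * L)
        ≡⟨ cong (λ t → (N + 2 * X) * (2 * t + (1 + N) * L)) formula′ ⟩
      (N + 2 * X) * (2 * ((1 + X + N) * O′ + (1 + X) * L′) + (1 + N) * L)
        ≡⟨ solve (X ∷ N ∷ O′ ∷ L ∷ L′ ∷ []) ℚ-ring ⟩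
      2 * (X + N + 1) * ((2 * X + N) * O′ + N * L) + (2 * X + N) * (2 * (X + 1) * L′)
        + ((2 * X + N) * (1 + N) + - (2 * (X + N + 1) * N)) * L
        ≡⟨ cong₂ (λ a b → 2 * (X + N + 1) * a + (2 * X + N) * b
                          + ((2 * X + N) * (1 + N) + - (2 * (X + N + 1) * N)) * L)
                 shift shiftL ⟩
      2 * (X + N + 1) * (2 * (X + N) * O) + (2 * X + N) * ((2 * X + (1 + N)) * L)
        + ((2 * X + N) * (1 + N) + - (2 * (X + N + 1) * N)) * L
        ≡⟨ solve (X ∷ N ∷ O ∷ L ∷ []) ℚ-ring ⟩
      4 * (X + (1 + N)) * ((X + N) * O + X * L)
        ≡⟨ cong (4 * (X + (1 + N)) *_) formula ⟨
      4 * (X + (1 + N)) * ((2 * X + N) * E)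
        ≡⟨ solve (X ∷ N ∷ E ∷ []) ℚ-ring ⟩
      (N + 2 * X) * (4 * (X + (1 + N)) * E)
        ∎
      where open ≡-Reasoning

  evenShift : ∀ m → EvenShift m (Pₑ m)
  evenShift zero x = identity ⟦ x ⟧
    where
    identity : ∀ X → 2 * (2 * X + 2 + 1) * 1 + 2 * 1 ≡ 4 * (X + 2) * 1
    identity = solve-∀ ℚ-ring
  evenShift (suc m) = oddShift⇒evenShift m (evenShift⇒oddShift m (evenShift m))

  Pₑ-at-0 : ∀ m → Pₑ m 0 ≡ ⟦ 4 ℕ.^ m ℕ.* m ℕ.! ⟧
  Pₒ-at-0 : ∀ m → Pₒ m 0 ≡ ⟦ 4 ℕ.^ suc m ℕ.* suc m ℕ.! ⟧

  Pₑ-at-0 zero = refl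
  Pₑ-at-0 (suc m) = trans (*-cancelˡ-⟦suc⟧ (2 ℕ.+ m ℕ.* 2) Pₑ-at-0≡Pₒ-at-0) (Pₒ-at-0 m)
    where
    identity : ∀ N E O L → (2 * 0 + N) * E ≡ (0 + N) * O + 0 * L → N * E ≡ N * O
    identity N E O L eq = begin
      N * E                  ≡⟨ solve (N ∷ E ∷ []) ℚ-ring ⟩
      (2 * 0 + N) * E        ≡⟨ eq ⟩
      (0 + N) * O + 0 * L    ≡⟨ solve (N ∷ O ∷ L ∷ []) ℚ-ring ⟩
      N * O                  ∎
      where open ≡-Reasoning

    Pₑ-at-0≡Pₒ-at-0 : ⟦ 3 ℕ.+ m ℕ.* 2 ⟧ * Pₑ (suc m) 0 ≡ ⟦ 3 ℕ.+ m ℕ.* 2 ⟧ * Pₒ m 0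
    Pₑ-at-0≡Pₒ-at-0 = identity ⟦ 3 ℕ.+ m ℕ.* 2 ⟧ (Pₑ (suc m) 0) (Pₒ m 0) (prodTo (suc m) 0)
                                (Pₑ-from-Pₒ m (evenShift⇒oddShift m (evenShift m)) 0)

  Pₒ-at-0 m = begin
    Pₒ m 0                                     ≡⟨ Pₒ-from-Pₑ m (evenShift m) 0 ⟩
    2 * (0 + N) * Pₑ m 0 + 0 * prodTo m 0      ≡⟨ cong (λ e → 2 * (0 + N) * e + 0 * prodTo m 0) (Pₑ-at-0 m) ⟩
    2 * (0 + N) * ⟦ v ⟧ + 0 * prodTo m 0       ≡⟨ identity N ⟦ v ⟧ (prodTo m 0) ⟩
    2 * N * ⟦ v ⟧                              ≡⟨ ⟦ cast 2 ⟨*⟩ cast (2 ℕ.+ m ℕ.* 2) ⟨*⟩ cast v ⟧≡ ⟨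
    ⟦ 2 ℕ.* (2 ℕ.+ m ℕ.* 2) ℕ.* v ⟧            ≡⟨ cong ⟦_⟧ (ℕ-identity m (4 ℕ.^ m) (m ℕ.!)) ⟩
    ⟦ 4 ℕ.^ suc m ℕ.* suc m ℕ.! ⟧              ∎
    where
    open ≡-Reasoning
    N = ⟦ 2 ℕ.+ m ℕ.* 2 ⟧
    v = 4 ℕ.^ m ℕ.* m ℕ.!
    identity : ∀ N V L → 2 * (0 + N) * V + 0 * L ≡ 2 * N * V
    identity = solve-∀ ℚ-ring
    ℕ-identity : ∀ m a b → 2 ℕ.* (2 ℕ.+ m ℕ.* 2) ℕ.* (a ℕ.* b) ≡ 4 ℕ.* a ℕ.* (b ℕ.+ m ℕ.* b)
    ℕ-identity = ℕ-Solver.solve-∀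

open import Data.Nat using (ℕ; _≤_; _∸_; _/_; _^_; _*_; _!)
open import Data.Nat.Divisibility using (divides)

data Parity : ℕ → Set where
  even : ∀ m → Parity (m * 2)
  odd  : ∀ m → Parity (suc (m * 2))

parity : ∀ k → Parity k
parity zero = even 0
parity (suc k) with parity k
... | even m = odd m
... | odd m  = even (suc m)

[1+m*2]/2≡m : ∀ m → suc (m * 2) / 2 ≡ m
[1+m*2]/2≡m m = trans (+-distrib-/-∣ʳ 1 {d = 2} (divides m refl)) (m*n/n≡m m 2)

mainTheorem3 : (n : ℕ) → 1 ≤ n → P n 0 ≡ ⟦ 4 ^ ((n ∸ 1) / 2) * ((n ∸ 1) / 2) ! ⟧
mainTheorem3 zero ()
mainTheorem3 (suc zero) _ = refl
mainTheorem3 (suc (suc k)) _ with parity k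
... | even m = trans (Pₑ-at-0 m) (cong (λ h → ⟦ 4 ^ h * h ! ⟧) (sym ([1+m*2]/2≡m m)))
... | odd m  = trans (Pₒ-at-0 m) (cong (λ h → ⟦ 4 ^ h * h ! ⟧) (sym (m*n/n≡m (suc m) 2)))
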